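{- Let $q\ge 1$ and $n\ge 2$ be integers, let $X$ be a connected $(q+1)$-regular undirected graph with $n$ vertices and adjacency matrix $A$, and let $k\ge 1$ be an integer. Then the procedure $\mathrm{Hsequence}(A,k)$ (defined in the context) runs in $O(n^\omega\log k)$ time.
   Context: $\omega$ is the exponent of matrix multiplication: an $n\times n$ matrix multiplication is taken to cost $O(n^\omega)$ time. Running time counts arithmetic operations on real numbers at unit cost (including square roots). $\log$ is base $2$. The bound is asymptotic (uniform over $n\ge 2$ and $k\ge 2$). Procedure $\mathrm{Indices}(k)$ (integer $k\ge 1$). Start with the array $L=(k)$, indexed from $0$. While $k$ is even: set $k\leftarrow k/2$ and append $k$ to the end of $L$. Then, while $k\ne 1$: set $k\leftarrow (k+1)/2$; append $k$ to $L$; append $k-1$ to $L$; if $k$ is even, set $k\leftarrow k-1$. Return $L$. Procedure $\mathrm{Hsequence}(A,k)$. Let $n$ be the number of rows of $A$, $q=(\text{a row sum of }A)-1$, $L=\mathrm{Indices}(k)$, $l$ the length of $L$. Let $T[0..3]$ be an array of matrices with $T[0]\leftarrow A$ and $Q[0..3]$ an array of numbers with $Q[0]\leftarrow 1$ (other entries initially unspecified). For $i=l-1$ down to $1$ do: (a) for $j=3,2,1$ (in this order) set $Q[j]\leftarrow Q[j-1]$ and $T[j]\leftarrow T[j-1]$; (b) if $L[i-1]$ is even: put $j\leftarrow 1$ if $L[i-1]=2L[i]$ and $j\leftarrow 2$ otherwise; put $Q[0]\leftarrow Q[j]^2$ if $L[i+j-1]$ is even and $Q[0]\leftarrow q\,Q[j]^2$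 otherwise; put $T[0]\leftarrow T[j]^2-2Q[0]I_n$, where $I_n$ is the identity matrix; (c) if $L[i-1]$ is odd: put $j\leftarrow 2$ if $L[i-1]=2L[i+1]-1$ and $j\leftarrow 1$ otherwise; put $Q[0]\leftarrow Q[j]Q[j+1]$; put $T[0]\leftarrow T[j]T[j+1]-Q[0]A$. After the loop: if $L[0]$ is odd, set $Q[0]\leftarrow q^{1/2}Q[0]$. Return $2(n-1)+Q[0]+Q[0]^{ -1}-Q[0]^{ -1}\,\mathrm{trace}(T[0])$. -}

module Defs where

open import Algebra.Bundles using (CommutativeRing; Semiring)
open import Algebra.Structures using (IsCommutativeRing)
import Algebra.Definitions.RawSemiring
open import Data.Bool.Base using (if_then_else_)
open import Data.Fin.Base using (Fin; zero; suc; inject₁; toℕ)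
open import Data.Fin.Patterns using (0F; 1F; 2F)
import Data.Fin.Properties as Fin
open import Data.List.Base using (List; []; _∷_; _∷ʳ_; length)
open import Data.Nat.Base as ℕ using (ℕ; zero; suc; NonZero; _/_; _∸_)
open import Data.Nat.Divisibility using (_∣_; _∣?_; ∣⇒≤)
open import Data.Nat.DivMod using (m/n<m; m≥n⇒m/n>0; m<n*o⇒m/o<n)
open import Data.Nat.Induction using (<-wellFounded)
import Data.Nat.Properties as ℕ
open import Data.Product.Base using (∃; _×_; _,_)
open import Data.Sum.Base using (_⊎_; inj₁; inj₂)
import Data.Vec.Base as Vec
open import Data.Vec.Base using (Vec; []; _∷_; lookup; _[_]≔_)
import Data.Vec.Functional as Vector
open import Data.Unit.Base using (⊤; tt)
open import Data.Vec.Functional using (Vector)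
open import Function.Base using (_∘_; _$_)
open import Induction.WellFounded using (Acc; acc)
open import Level using (0ℓ)
open import Relation.Binary.Construct.Closure.ReflexiveTransitive using (Star)
open import Relation.Binary.PropositionalEquality.Core using (_≡_; _≢_; refl; cong)
open import Relation.Binary.Structures using (IsTotalOrder)
open import Relation.Nullary using (¬_; Dec; yes; no; does; contradiction)

------------------------------------------------------------------------
-- The real numbers

-- A complete ordered field.  Classically this determines ℝ up to
-- isomorphism.  The operations _⁻¹ and sup are total; their values are
-- constrained only where they are mathematically meaningful.

record RealNumbers : Set₁ where
  infix  8 _⁻¹
  infix  8 -_
  infixl 7 _*_
  infixl 6 _+_
  infix  4 _≈_ _≤_
  field
    ℝ                 : Set
    _≈_ _≤_           : ℝ → ℝ → Set
    _+_ _*_           : ℝ → ℝ → ℝ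
    -_ _⁻¹            : ℝ → ℝ
    0# 1#             : ℝ
    isCommutativeRing : IsCommutativeRing _≈_ _+_ _*_ -_ 0# 1#
    0≉1               : ¬ (0# ≈ 1#)
    ⁻¹-cong           : ∀ {x y} → x ≈ y → x ⁻¹ ≈ y ⁻¹
    *-inverseʳ        : ∀ {x} → ¬ (x ≈ 0#) → x * x ⁻¹ ≈ 1#
    isTotalOrder      : IsTotalOrder _≈_ _≤_
    +-monoʳ-≤         : ∀ x {y z} → y ≤ z → x + y ≤ x + z
    *-nonNeg          : ∀ {x y} → 0# ≤ x → 0# ≤ y → 0# ≤ x * y

  IsUpperBound : (ℝ → Set) → ℝ → Set
  IsUpperBound P u = ∀ x → P x → x ≤ u

  field
    sup       : (ℝ → Set) → ℝ
    sup-upper : ∀ P → ∃ P → ∃ (IsUpperBound P) → IsUpperBound P (sup P)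
    sup-least : ∀ P → ∃ P → ∃ (IsUpperBound P) →
                ∀ u → IsUpperBound P u → sup P ≤ u

  commutativeRing : CommutativeRing 0ℓ 0ℓ
  commutativeRing = record { isCommutativeRing = isCommutativeRing }

  infixl 6 _-_
  _-_ : ℝ → ℝ → ℝ
  x - y = x + (- y)

  open Algebra.Definitions.RawSemiring
         (Semiring.rawSemiring (CommutativeRing.semiring commutativeRing)) public
    using (_^_; sum) renaming (_×_ to _×ℝ_)

  fromℕ : ℕ → ℝ
  fromℕ n = n ×ℝ 1#

  sqrt : ℝ → ℝ
  sqrt x = sup λ y → y * y ≤ x

  -- n^τ for n ≥ 1 and an arbitrary real exponent τ: the supremum of n^r
  -- over the rationals r = (p - m)/b ≤ τ, where y ≤ n^r is written, for
  -- y ≥ 0, as y^b n^m ≤ n^p.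
  infixr 8 _^ℝ_
  _^ℝ_ : ℕ → ℝ → ℝ
  n ^ℝ τ = sup λ y → 0# ≤ y × ∃ λ p → ∃ λ m → ∃ λ b →
    1 ℕ.≤ b ×
    fromℕ p ≤ τ * fromℕ b + fromℕ m ×
    y ^ b * fromℕ n ^ m ≤ fromℕ n ^ p

  -- log₂ k for k ≥ 1: the supremum of the rationals a/b with 2^a ≤ k^b.
  log₂ : ℕ → ℝ
  log₂ k = sup λ y → ∃ λ a → ∃ λ b →
    1 ℕ.≤ b × y * fromℕ b ≈ fromℕ a × 2 ℕ.^ a ℕ.≤ k ℕ.^ b

------------------------------------------------------------------------
-- Graphs

-- Loops and multiple edges are permitted: multiplicity u v is the (u, v)
-- entry of the adjacency matrix.  A simple graph is the case of a 0-1
-- matrix with zero diagonal.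

record RegularGraph (d n : ℕ) : Set where
  field
    multiplicity : Fin n → Fin n → ℕ
    symmetric    : ∀ u v → multiplicity u v ≡ multiplicity v u
    regular      : ∀ u → Vec.sum (Vec.tabulate (multiplicity u)) ≡ d

  Adjacent : Fin n → Fin n → Set
  Adjacent u v = multiplicity u v ≢ 0

  field
    connected : ∀ u v → Star Adjacent u v

------------------------------------------------------------------------
-- Computations with a step counter

infixr 4 _▹_

record Timed (X : Set) : Set where
  constructor _▹_
  field
    steps  : ℕ
    result : X

open Timed public

return : {X : Set} → X → Timed X
return x = 0 ▹ x

tick : {X : Set} → X → Timed X
tick x = 1 ▹ x

infixl 1 _>>=_ _>>_

_>>=_ : {X Y : Set} → Timed X → (X → Timed Y) → Timed Y
(s ▹ x) >>= f = (s ℕ.+ steps (f x)) ▹ result (f x)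

_>>_ : {X Y : Set} → Timed X → Timed Y → Timed Y
p >> p′ = p >>= λ _ → p′

forEach : {X : Set} (n : ℕ) → (Fin n → Timed X) → Timed (Vector X n)
forEach zero    f = return Vector.[]
forEach (suc n) f = do
  x  ← f zero
  xs ← forEach n (f ∘ suc)
  return (x Vector.∷ xs)

charge : ℕ → Timed ⊤
charge s = s ▹ tt

-- Integer operations, tests, assignments and array accesses also cost one
-- step each; the arithmetic in a subscript is part of the access.

even? : (k : ℕ) → Timed (Dec (2 ∣ k))
even? k = tick (2 ∣? k)

_≟ᵗ_ : (a b : ℕ) → Timed (Dec (a ≡ b))
a ≟ᵗ b = tick (a ℕ.≟ b)

append : List ℕ → ℕ → Timed (List ℕ)
append L k = tick (L ∷ʳ k)

-- The default 0 is never returned in Hsequence: for k ≥ 2 the array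
-- Indices(k) ends in 2, 1, so that all its subscripts are in range.
infixl 9 _!_
_!_ : List ℕ → ℕ → ℕ
[]      ! i     = 0
(k ∷ L) ! zero  = k
(k ∷ L) ! suc i = L ! i

read : List ℕ → ℕ → Timed ℕ
read L i = tick (L ! i)

------------------------------------------------------------------------
-- Indices

private
  2∣⇒half≢0 : ∀ {k} .{{_ : NonZero k}} → 2 ∣ k → NonZero (k / 2)
  2∣⇒half≢0 2∣k = ℕ.>-nonZero (m≥n⇒m/n>0 (∣⇒≤ 2∣k))

  2∣⇒pred≢0 : ∀ {k} .{{_ : NonZero k}} → 2 ∣ k → NonZero (k ∸ 1)
  2∣⇒pred≢0 2∣k = ℕ.>-nonZero (ℕ.∸-monoˡ-≤ 1 (∣⇒≤ 2∣k))

  half< : ∀ k .{{_ : NonZero k}} → k / 2 ℕ.< k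
  half< k = m/n<m k 2 (ℕ.s≤s (ℕ.s≤s ℕ.z≤n))

  roundUp≢0 : ∀ k .{{_ : NonZero k}} → NonZero ((k ℕ.+ 1) / 2)
  roundUp≢0 k = ℕ.>-nonZero (m≥n⇒m/n>0 (ℕ.+-monoˡ-≤ 1 (ℕ.>-nonZero⁻¹ k)))

  roundUp< : ∀ k .{{_ : NonZero k}} → k ≢ 1 → (k ℕ.+ 1) / 2 ℕ.< k
  roundUp< (suc zero)      k≢1 = contradiction refl k≢1
  roundUp< k@(suc (suc m)) _   = m<n*o⇒m/o<n {n = k} {o = 2} $ begin-strict
    k ℕ.+ 1           <⟨ ℕ.+-monoʳ-< k (ℕ.s≤s (ℕ.s≤s ℕ.z≤n)) ⟩
    k ℕ.+ k           ≡⟨ cong (k ℕ.+_) (ℕ.+-identityʳ k) ⟨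
    2 ℕ.* k           ≡⟨ ℕ.*-comm 2 k ⟩
    k ℕ.* 2           ∎
    where open ℕ.≤-Reasoning

-- The two while loops, the first followed by the second.  The
-- accessibility arguments only justify termination.

whileNotOne : List ℕ → (k : ℕ) .{{_ : NonZero k}} → Acc ℕ._<_ k →
              Timed (List ℕ)
whileNotOne L k (acc rec) = do
  no k≢1 ← k ≟ᵗ 1
    where yes _ → return L
  let k′ = (k ℕ.+ 1) / 2
  charge 3
  L ← append L k′
  charge 1
  L ← append L (k′ ∸ 1)
  yes 2∣k′ ← even? k′
    where no _ → whileNotOne L k′ {{roundUp≢0 k}} (rec (roundUp< k k≢1))
  charge 2
  whileNotOne L (k′ ∸ 1) {{2∣⇒pred≢0 {{roundUp≢0 k}} 2∣k′}}
    (rec (ℕ.≤-<-trans (ℕ.m∸n≤m k′ 1) (roundUp< k k≢1)))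

whileEven : List ℕ → (k : ℕ) .{{_ : NonZero k}} → Acc ℕ._<_ k →
            Timed (List ℕ)
whileEven L k ac@(acc rec) = do
  yes 2∣k ← even? k
    where no _ → whileNotOne L k ac
  let k′ = k / 2
  charge 2
  L ← append L k′
  whileEven L k′ {{2∣⇒half≢0 2∣k}} (rec (half< k))

Indices : (k : ℕ) .{{_ : NonZero k}} → Timed (List ℕ)
Indices k = do
  L ← append [] k
  whileEven L k (<-wellFounded k)

------------------------------------------------------------------------
-- Computations with real numbers

module RealComputation (R : RealNumbers) where

  open RealNumbers R

  Matrix : ℕ → Set
  Matrix n = Fin n → Fin n → ℝ

  -- Arithmetic straight-line programs over a family x : I → ℝ of inputs.
  -- A program of length s has one register per instruction, register 0F
  -- being the most recent.  Real constants are free of charge.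

  data Operand (I : Set) (s : ℕ) : Set where
    input    : I → Operand I s
    register : Fin s → Operand I s
    constant : ℝ → Operand I s

  data Instruction (I : Set) (s : ℕ) : Set where
    add sub mul div : Operand I s → Operand I s → Instruction I s
    root            : Operand I s → Instruction I s

  data Program (I : Set) : ℕ → Set where
    []  : Program I 0
    _▷_ : ∀ {s} → Program I s → Instruction I s → Program I (suc s)

  module _ {I : Set} (x : I → ℝ) where

    value : ∀ {s} → Vec ℝ s → Operand I s → ℝ
    value ρ (input i)    = x i
    value ρ (register j) = lookup ρ j
    value ρ (constant c) = c

    execute : ∀ {s} → Vec ℝ s → Instruction I s → ℝ
    execute ρ (add a b) = value ρ a + value ρ b
    execute ρ (sub a b) = value ρ a - value ρ b
    execute ρ (mul a b) = value ρ a * value ρ b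
    execute ρ (div a b) = value ρ a * value ρ b ⁻¹
    execute ρ (root a)  = sqrt (value ρ a)

    run : ∀ {s} → Program I s → Vec ℝ s
    run []      = []
    run (p ▷ e) = execute (run p) e ∷ run p

  -- The inputs of a multiplication program are the entries of the two
  -- factors.
  Entry : ℕ → Set
  Entry n = (Fin n × Fin n) ⊎ (Fin n × Fin n)

  entries : ∀ {n} → Matrix n → Matrix n → Entry n → ℝ
  entries A B (inj₁ (i , j)) = A i j
  entries A B (inj₂ (i , j)) = B i j

  record MatrixMultiplication (n : ℕ) : Set where
    field
      cost    : ℕ
      program : Program (Entry n) cost
      output  : Fin n → Fin n → Operand (Entry n) cost

    product : Matrix n → Matrix n → Matrix n
    product A B i j =
      value (entries A B) (run (entries A B) program) (output i j)

    field
      correct : ∀ A B i j → product A B i j ≈ sum (λ l → A i l * B l j)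

  _⊕_ _⊖_ _⊗_ : ℝ → ℝ → Timed ℝ
  x ⊕ y = tick (x + y)
  x ⊖ y = tick (x - y)
  x ⊗ y = tick (x * y)

  inverseᵗ sqrtᵗ : ℝ → Timed ℝ
  inverseᵗ x = tick (x ⁻¹)
  sqrtᵗ    x = tick (sqrt x)

  sumᵗ : ∀ {n} → Vector ℝ n → Timed ℝ
  sumᵗ {zero}  v = return 0#
  sumᵗ {suc n} v = do
    s ← sumᵗ (Vector.tail v)
    Vector.head v ⊕ s

  traceᵗ : ∀ {n} → Matrix n → Timed ℝ
  traceᵗ M = sumᵗ λ i → M i i

  entrywise : ∀ {n} → (Fin n → Fin n → Timed ℝ) → Timed (Matrix n)
  entrywise {n} f = forEach n λ i → forEach n λ j → f i j

  copyᴹ : ∀ {n} → Matrix n → Timed (Matrix n)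
  copyᴹ M = entrywise λ i j → tick (M i j)

  scaleᴹ : ∀ {n} → ℝ → Matrix n → Timed (Matrix n)
  scaleᴹ c M = entrywise λ i j → c ⊗ M i j

  _⊖ᴹ_ : ∀ {n} → Matrix n → Matrix n → Timed (Matrix n)
  M ⊖ᴹ N = entrywise λ i j → M i j ⊖ N i j

  identityᴹ : ∀ {n} → Matrix n
  identityᴹ i j = if does (i Fin.≟ j) then 1# else 0#

  adjacencyMatrix : ∀ {d n} → RegularGraph d n → Matrix n
  adjacencyMatrix X u v = fromℕ (RegularGraph.multiplicity X u v)

  ----------------------------------------------------------------------
  -- Hsequence

  record Registers (n : ℕ) : Set where
    constructor ⟨_,_⟩
    field
      T : Vec (Matrix n) 4
      Q : Vec ℝ 4

  module Loop {n : ℕ} (mm : MatrixMultiplication n)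
              (A : Matrix n) (q : ℝ) (L : List ℕ) where

    open MatrixMultiplication mm using (cost; product)

    2ℝ : ℝ
    2ℝ = fromℕ 2

    _⊗ᴹ_ : Matrix n → Matrix n → Timed (Matrix n)
    M ⊗ᴹ N = cost ▹ product M N

    -- For j = suc j′: Q[j] ← Q[j-1] and T[j] ← T[j-1].
    shift : Fin 3 → Registers n → Timed (Registers n)
    shift j′ ⟨ T , Q ⟩ = do
      x ← tick (lookup Q (inject₁ j′))
      M ← copyᴹ (lookup T (inject₁ j′))
      return ⟨ T [ suc j′ ]≔ M , Q [ suc j′ ]≔ x ⟩

    -- In the next three definitions the loop variable of the procedure
    -- is suc i, and j : Fin 3 is a subscript such that j + 1 ≤ 3.

    evenCase : ℕ → Registers n → Timed (Registers n)
    evenCase i ⟨ T , Q ⟩ = do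
      a  ← read L i
      b  ← read L (suc i)
      2b ← tick (2 ℕ.* b)
      t  ← a ≟ᵗ 2b
      j  ← tick (if does t then 1F else 2F)
      let Tⱼ = lookup T (inject₁ j)
          Qⱼ = lookup Q (inject₁ j)
      c  ← read L (i ℕ.+ toℕ j)
      e  ← even? c
      x² ← Qⱼ ⊗ Qⱼ
      x  ← (if does e then return x² else q ⊗ x²)
      M² ← Tⱼ ⊗ᴹ Tⱼ
      2x ← 2ℝ ⊗ x
      N  ← scaleᴹ 2x identityᴹ
      M  ← M² ⊖ᴹ N
      charge 1
      return ⟨ T [ 0F ]≔ M , Q [ 0F ]≔ x ⟩

    oddCase : ℕ → Registers n → Timed (Registers n)
    oddCase i ⟨ T , Q ⟩ = do
      a    ← read L i
      b    ← read L (2 ℕ.+ i)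
      2b   ← tick (2 ℕ.* b)
      2b-1 ← tick (2b ∸ 1)
      t    ← a ≟ᵗ 2b-1
      j    ← tick (if does t then 2F else 1F)
      x    ← lookup Q (inject₁ j) ⊗ lookup Q (suc j)
      P    ← lookup T (inject₁ j) ⊗ᴹ lookup T (suc j)
      N    ← scaleᴹ x A
      M    ← P ⊖ᴹ N
      charge 1
      return ⟨ T [ 0F ]≔ M , Q [ 0F ]≔ x ⟩

    body : ℕ → Registers n → Timed (Registers n)
    body i r = do
      r ← shift 2F r
      r ← shift 1F r
      r ← shift 0F r
      a ← read L i
      e ← even? a
      if does e then evenCase i r else oddCase i r

    -- The iterations i, i - 1, …, 1.
    loop : ℕ → Registers n → Timed (Registers n)
    loop zero    r = return r
    loop (suc i) r = do
      charge 1
      r ← body i r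
      loop i r

  -- row is the row whose sum is used to compute q, and T₁₋₃, Q₁₋₃ are the
  -- unspecified initial contents of the two arrays.
  Hsequence : ∀ {n} → MatrixMultiplication n →
              (row : Fin n) (T₁₋₃ : Vec (Matrix n) 3) (Q₁₋₃ : Vec ℝ 3) →
              Matrix n → (k : ℕ) .{{_ : NonZero k}} → Timed ℝ
  Hsequence {n} mm row T₁₋₃ Q₁₋₃ A k = do
    s  ← sumᵗ (A row)
    q  ← s ⊖ 1#
    L  ← Indices k
    l  ← tick (length L)
    A₀ ← copyᴹ A
    charge 1
    let open Loop mm A q L
    ⟨ T , Q ⟩ ← loop (l ∸ 1) ⟨ A₀ ∷ T₁₋₃ , 1# ∷ Q₁₋₃ ⟩
    a  ← read L 0
    e  ← even? a
    x  ← (if does e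
            then return (lookup Q 0F)
            else (sqrtᵗ q >>= λ √q → √q ⊗ lookup Q 0F))
    -- 2(n - 1) + x + x⁻¹ - x⁻¹ trace(T[0])
    n-1  ← fromℕ n ⊖ 1#
    u    ← 2ℝ ⊗ n-1
    v    ← u ⊕ x
    x⁻¹  ← inverseᵗ x
    w    ← v ⊕ x⁻¹
    tr   ← traceᵗ (lookup T 0F)
    x⁻¹′ ← inverseᵗ x
    y    ← x⁻¹′ ⊗ tr
    w ⊖ y

{-# OPTIONS --safe #-}
module Submission where

-- A correct multiplication program must read every entry of its left factor,
-- and each instruction reads at most two, so n² ≤ 2 cost.  Hence every entrywise
-- matrix operation is dominated by one multiplication, and the exponent ω
-- enters only through cost ≤ c n^ω.  If 2^m ≤ k < 2^(m+1), then Indices(k)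
-- appends at most 2(m+1) terms, because halving and rounding up both send
-- k ≤ 2^(M+1) to a number ≤ 2^M, and m ≤ log₂ k.

open import Defs
open import Algebra.Bundles using (CommutativeRing)
import Algebra.Properties.Monoid.Sum
import Algebra.Properties.Ring
import Algebra.Properties.Semiring.Mult
open import Data.Bool.Base using (true; false; if_then_else_)
open import Data.Fin.Base using (Fin; zero; suc; toℕ; remQuot; combine)
open import Data.Fin.Patterns using (0F; 1F; 2F)
import Data.Fin.Properties as Fin
open import Data.List.Base using (List; []; _∷_; _∷ʳ_; _++_; length)
import Data.List.Base as List
open import Data.List.Membership.Propositional using (_∈_)
open import Data.List.Membership.Propositional.Properties using (∈-++⁺ˡ; ∈-++⁺ʳ)
import Data.List.Membership.DecPropositional
open import Data.List.Properties using (length-++)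
open import Data.List.Relation.Unary.Any using (here; index)
open import Data.List.Relation.Unary.Any.Properties using (lookup-index)
open import Data.Nat.Base as ℕ using (ℕ; zero; suc; NonZero; z≤n; s≤s; _/_; _∸_)
open import Data.Nat.Divisibility using (_∣_; _∣?_; ∣⇒≤)
open import Data.Nat.DivMod using (m<n*o⇒m/o<n; m≥n⇒m/n>0)
open import Data.Nat.Induction using (<-wellFounded)
import Data.Nat.Properties as ℕ
open import Data.Nat.Tactic.RingSolver using (solve-∀)
open import Data.Product.Base using (∃; _×_; _,_; proj₁; proj₂; uncurry)
import Data.Product.Properties as Product
open import Data.Sum.Base using (inj₁; inj₂)
import Data.Sum.Properties as Sum
open import Data.Vec.Base using (Vec; []; _∷_; lookup)
open import Data.Vec.Functional using (Vector)
open import Function.Base using (_∘_)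
open import Induction.WellFounded using (Acc; acc)
open import Relation.Binary.Bundles using (Poset)
open import Relation.Binary.Definitions using (DecidableEquality)
open import Relation.Binary.PropositionalEquality
  using (_≡_; _≢_; refl; cong; cong₂; sym; trans; subst; module ≡-Reasoning)
import Relation.Binary.Reasoning.PartialOrder
open import Relation.Binary.Structures using (IsTotalOrder)
open import Relation.Nullary using (yes; no; does; contradiction)
open import Relation.Nullary.Decidable using (dec-true; dec-false)

-- Step counts of loops and branches.

steps-forEach : ∀ {X : Set} n {f : Fin n → Timed X} {s} →
                (∀ i → steps (f i) ℕ.≤ s) → steps (forEach n f) ℕ.≤ n ℕ.* s
steps-forEach zero    f≤s = z≤n
steps-forEach (suc n) f≤s = ℕ.+-mono-≤ (f≤s zero)
  (ℕ.≤-trans (ℕ.≤-reflexive (ℕ.+-identityʳ _)) (steps-forEach n (f≤s ∘ suc)))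

steps-if : ∀ {X : Set} b {x y : Timed X} {s} → steps x ℕ.≤ s → steps y ℕ.≤ s →
           steps (if b then x else y) ℕ.≤ s
steps-if true  x≤s y≤s = x≤s
steps-if false x≤s y≤s = y≤s

-- Running time and length of `Indices`, and powers of two.

length-∷ʳ : ∀ (L : List ℕ) k → length (L ∷ʳ k) ≡ suc (length L)
length-∷ʳ L k = trans (length-++ L) (ℕ.+-comm (length L) 1)

private
  double : ∀ m → 2 ℕ.^ suc m ≡ 2 ℕ.^ m ℕ.* 2
  double m = ℕ.*-comm 2 (2 ℕ.^ m)

-- Since `k + 1` is at most `2 ^ suc m + 1`, it is still below twice `suc (2 ^ m)`, so the quotient
-- is below `suc (2 ^ m)`: rounding up costs nothing at a power of two.
roundUp≤2^ : ∀ {k m} → k ℕ.≤ 2 ℕ.^ suc m → (k ℕ.+ 1) / 2 ℕ.≤ 2 ℕ.^ m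
roundUp≤2^ {k} {m} k≤ = ℕ.s≤s⁻¹ (m<n*o⇒m/o<n {n = suc (2 ℕ.^ m)} {o = 2} (begin
  suc (k ℕ.+ 1)           ≡⟨ cong suc (ℕ.+-comm k 1) ⟩
  2 ℕ.+ k                 ≤⟨ ℕ.+-monoʳ-≤ 2 k≤ ⟩
  2 ℕ.+ 2 ℕ.^ suc m       ≡⟨ cong (2 ℕ.+_) (double m) ⟩
  suc (2 ℕ.^ m) ℕ.* 2     ∎))
  where open ℕ.≤-Reasoning

half≤2^ : ∀ {k m} → k ℕ.≤ 2 ℕ.^ suc m → k / 2 ℕ.≤ 2 ℕ.^ m
half≤2^ {k} {m} k≤ = ℕ.s≤s⁻¹ (m<n*o⇒m/o<n {n = suc (2 ℕ.^ m)} {o = 2} (begin-strict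
  k                       ≤⟨ k≤ ⟩
  2 ℕ.^ suc m             ≡⟨ double m ⟩
  2 ℕ.^ m ℕ.* 2           <⟨ ℕ.m<n+m _ (s≤s z≤n) ⟩
  suc (2 ℕ.^ m) ℕ.* 2     ∎))
  where open ℕ.≤-Reasoning

-- The `NonZero` arguments of the two while loops are irrelevant, so any proofs of nonzeroness serve
-- to name the recursive calls.
2∣⇒half≢0 : ∀ {k} .{{_ : NonZero k}} → 2 ∣ k → NonZero (k / 2)
2∣⇒half≢0 2∣k = ℕ.>-nonZero (m≥n⇒m/n>0 (∣⇒≤ 2∣k))

2∣⇒pred≢0 : ∀ {k} .{{_ : NonZero k}} → 2 ∣ k → NonZero (k ∸ 1)
2∣⇒pred≢0 2∣k = ℕ.>-nonZero (ℕ.∸-monoˡ-≤ 1 (∣⇒≤ 2∣k))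

roundUp≢0 : ∀ k .{{_ : NonZero k}} → NonZero ((k ℕ.+ 1) / 2)
roundUp≢0 k = ℕ.>-nonZero (m≥n⇒m/n>0 (ℕ.+-monoˡ-≤ 1 (ℕ.>-nonZero⁻¹ k)))

-- Bookkeeping for one append: the new term is charged to the remaining budget `m`.
length-∷ʳ≤ : ∀ L k {m n} → n ℕ.≤ length (L ∷ʳ k) ℕ.+ m → n ℕ.≤ length L ℕ.+ suc m
length-∷ʳ≤ L k {m} {n} n≤ = begin
  n                       ≤⟨ n≤ ⟩
  length (L ∷ʳ k) ℕ.+ m   ≡⟨ cong (ℕ._+ m) (length-∷ʳ L k) ⟩
  suc (length L) ℕ.+ m    ≡⟨ ℕ.+-suc (length L) m ⟨
  length L ℕ.+ suc m      ∎
  where open ℕ.≤-Reasoning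

-- Each round takes at most 10 steps, appends two terms and lowers the exponent `m` by one; the
-- extra step is the final test `k = 1`.
whileNotOne-bounds : ∀ m L k .{{_ : NonZero k}} (a : Acc ℕ._<_ k) → k ℕ.≤ 2 ℕ.^ m →
  steps (whileNotOne L k a) ℕ.≤ 1 ℕ.+ m ℕ.* 10 ×
  length (result (whileNotOne L k a)) ℕ.≤ length L ℕ.+ m ℕ.* 2
whileNotOne-bounds zero L (suc zero) (acc rec) k≤ =
  ℕ.≤-refl , ℕ.m≤m+n (length L) 0
whileNotOne-bounds zero L (suc (suc k)) (acc rec) (s≤s ())
whileNotOne-bounds (suc m) L k (acc rec) k≤ with k ℕ.≟ 1
... | yes _ = s≤s z≤n , ℕ.m≤m+n (length L) _
... | no k≢1 with 2 ∣? (k ℕ.+ 1) / 2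
...   | no _ =
  let k′ = (k ℕ.+ 1) / 2
      L′ = L ∷ʳ k′
      s , l = whileNotOne-bounds m (L′ ∷ʳ (k′ ∸ 1)) k′ {{roundUp≢0 k}} (rec _)
                (roundUp≤2^ {m = m} k≤)
  -- A round that leaves `k′` unchanged omits the last assignment and takes 8 steps.
  in ℕ.≤-trans (ℕ.+-monoʳ-≤ 8 s) (ℕ.m≤n+m _ 2) ,
     length-∷ʳ≤ L k′ (length-∷ʳ≤ L′ (k′ ∸ 1) l)
...   | yes 2∣k′ =
  let k′ = (k ℕ.+ 1) / 2
      L′ = L ∷ʳ k′
      s , l = whileNotOne-bounds m (L′ ∷ʳ (k′ ∸ 1)) (k′ ∸ 1)
                {{2∣⇒pred≢0 {{roundUp≢0 k}} 2∣k′}} (rec _)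
                (ℕ.≤-trans (ℕ.m∸n≤m k′ 1) (roundUp≤2^ {m = m} k≤))
  in ℕ.+-monoʳ-≤ 10 s , length-∷ʳ≤ L k′ (length-∷ʳ≤ L′ (k′ ∸ 1) l)

-- Both loops draw on the same exponent `m`, because halving has already lowered it when the second
-- loop starts. A round here takes 4 steps and appends one term, less than the budget of 10 and 2;
-- the failing parity test adds one step.
whileEven-bounds : ∀ m L k .{{_ : NonZero k}} (a : Acc ℕ._<_ k) → k ℕ.≤ 2 ℕ.^ m →
  steps (whileEven L k a) ℕ.≤ 2 ℕ.+ m ℕ.* 10 ×
  length (result (whileEven L k a)) ℕ.≤ length L ℕ.+ m ℕ.* 2
whileEven-bounds m L k a@(acc rec) k≤ with 2 ∣? k
... | no _ = let s , l = whileNotOne-bounds m L k a k≤ in s≤s s , l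
whileEven-bounds zero L k (acc rec) k≤ | yes 2∣k =
  contradiction (ℕ.≤-trans (∣⇒≤ 2∣k) k≤) λ { (s≤s ()) }
whileEven-bounds (suc m) L k (acc rec) k≤ | yes 2∣k =
  let s , l = whileEven-bounds m (L ∷ʳ k / 2) (k / 2) {{2∣⇒half≢0 2∣k}} (rec _)
                (half≤2^ {m = m} k≤)
  in ℕ.≤-trans (ℕ.+-monoʳ-≤ 4 s) (ℕ.m≤n+m _ 6) ,
     ℕ.≤-trans (length-∷ʳ≤ L (k / 2) l) (ℕ.+-monoʳ-≤ (length L) (ℕ.n≤1+n _))

Indices-bounds : ∀ m k .{{_ : NonZero k}} → k ℕ.≤ 2 ℕ.^ m →
  steps (Indices k) ℕ.≤ 3 ℕ.+ m ℕ.* 10 ×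
  length (result (Indices k)) ℕ.≤ 1 ℕ.+ m ℕ.* 2
Indices-bounds m k k≤ =
  let s , l = whileEven-bounds m (k ∷ []) k (<-wellFounded k) k≤ in s≤s s , l

-- The lower bound will compare `m` with `log₂ k`, the upper one will bound `Indices k`.
binaryMagnitude : ∀ k .{{_ : NonZero k}} → ∃ λ m → 2 ℕ.^ m ℕ.≤ k × k ℕ.< 2 ℕ.^ suc m
binaryMagnitude (suc zero)        = 0 , s≤s z≤n , s≤s (s≤s z≤n)
binaryMagnitude (suc k@(suc _)) with binaryMagnitude k
... | m , lo , hi with suc k ℕ.<? 2 ℕ.^ suc m
...   | yes hi′ = m , ℕ.m≤n⇒m≤1+n lo , hi′
...   | no ¬hi′ = suc m , ℕ.≮⇒≥ ¬hi′ ,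
  ℕ.≤-<-trans hi (ℕ.^-monoʳ-< 2 (s≤s (s≤s z≤n)) (ℕ.n<1+n (suc m)))

n<2^n : ∀ n → n ℕ.< 2 ℕ.^ n
n<2^n zero    = s≤s z≤n
n<2^n (suc n) = ℕ.≤-<-trans (n<2^n n) (ℕ.^-monoʳ-< 2 (s≤s (s≤s z≤n)) (ℕ.n<1+n n))

-- Ordered-field inequalities and a lower bound for `log₂`.

module RealProperties (R : RealNumbers) where

  open RealNumbers R
  private module ℝ = CommutativeRing commutativeRing
  open Algebra.Properties.Ring ℝ.ring
    using (-1*x≈-x; -‿involutive; [y-z]x≈yx-zx; x[y-z]≈xy-xz; //-rightDividesˡ)
  open Algebra.Properties.Semiring.Mult ℝ.semiring using (×1-homo-*)

  poset : Poset _ _ _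
  poset = record { isPartialOrder = IsTotalOrder.isPartialOrder isTotalOrder }

  open Poset poset public using ()
    renaming (refl to ≤-refl; trans to ≤-trans; reflexive to ≤-reflexive)
  open Relation.Binary.Reasoning.PartialOrder poset

  +-mono-≤ : ∀ {x y u v} → x ≤ y → u ≤ v → x + u ≤ y + v
  +-mono-≤ {x} {y} {u} {v} x≤y u≤v = begin
    x + u   ≤⟨ +-monoʳ-≤ x u≤v ⟩
    x + v   ≈⟨ ℝ.+-comm x v ⟩
    v + x   ≤⟨ +-monoʳ-≤ v x≤y ⟩
    v + y   ≈⟨ ℝ.+-comm v y ⟩
    y + v   ∎

  y≤x⇒0≤x-y : ∀ {x y} → y ≤ x → 0# ≤ x - y
  y≤x⇒0≤x-y {x} {y} y≤x = begin
    0#      ≈⟨ ℝ.-‿inverseʳ y ⟨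
    y - y   ≤⟨ +-mono-≤ y≤x ≤-refl ⟩
    x - y   ∎

  x-y≤0⇒x≤y : ∀ {x y} → x - y ≤ 0# → x ≤ y
  x-y≤0⇒x≤y {x} {y} x-y≤0 = begin
    x           ≈⟨ //-rightDividesˡ y x ⟨
    x - y + y   ≤⟨ +-mono-≤ x-y≤0 ≤-refl ⟩
    0# + y      ≈⟨ ℝ.+-identityˡ y ⟩
    y           ∎

  *-monoʳ-≤ : ∀ {x y z} → 0# ≤ x → y ≤ z → x * y ≤ x * z
  *-monoʳ-≤ {x} {y} {z} 0≤x y≤z = begin
    x * y                     ≈⟨ ℝ.+-identityˡ (x * y) ⟨
    0# + x * y                ≤⟨ +-mono-≤ (*-nonNeg 0≤x (y≤x⇒0≤x-y y≤z)) ≤-refl ⟩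
    x * (z - y) + x * y       ≈⟨ ℝ.+-congʳ (x[y-z]≈xy-xz x z y) ⟩
    x * z - x * y + x * y     ≈⟨ //-rightDividesˡ (x * y) (x * z) ⟩
    x * z                     ∎

  *-mono-≤ : ∀ {x y u v} → 0# ≤ y → 0# ≤ u → x ≤ y → u ≤ v → x * u ≤ y * v
  *-mono-≤ {x} {y} {u} {v} 0≤y 0≤u x≤y u≤v = begin
    x * u   ≈⟨ ℝ.*-comm x u ⟩
    u * x   ≤⟨ *-monoʳ-≤ 0≤u x≤y ⟩
    u * y   ≈⟨ ℝ.*-comm u y ⟩
    y * u   ≤⟨ *-monoʳ-≤ 0≤y u≤v ⟩
    y * v   ∎

  0≤1 : 0# ≤ 1#
  0≤1 with IsTotalOrder.total isTotalOrder 0# 1#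
  ... | inj₁ 0≤1 = 0≤1
  ... | inj₂ 1≤0 = begin
    0#              ≤⟨ *-nonNeg 0≤-1 0≤-1 ⟩
    - 1# * - 1#     ≈⟨ -1*x≈-x (- 1#) ⟩
    - - 1#          ≈⟨ -‿involutive 1# ⟩
    1#              ∎
    where
    0≤-1 : 0# ≤ - 1#
    0≤-1 = ≤-trans (y≤x⇒0≤x-y 1≤0) (≤-reflexive (ℝ.+-identityˡ (- 1#)))

  0≤fromℕ : ∀ n → 0# ≤ fromℕ n
  0≤fromℕ zero    = ≤-refl
  0≤fromℕ (suc n) = begin
    0#             ≈⟨ ℝ.+-identityˡ 0# ⟨
    0# + 0#        ≤⟨ +-mono-≤ 0≤1 (0≤fromℕ n) ⟩
    fromℕ (suc n)  ∎

  fromℕ-mono-≤ : ∀ {m n} → m ℕ.≤ n → fromℕ m ≤ fromℕ n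
  fromℕ-mono-≤ {n = n} z≤n = 0≤fromℕ n
  fromℕ-mono-≤ (s≤s m≤n)   = +-monoʳ-≤ 1# (fromℕ-mono-≤ m≤n)

  fromℕ-homo-* : ∀ m n → fromℕ (m ℕ.* n) ≈ fromℕ m * fromℕ n
  fromℕ-homo-* = ×1-homo-*

  fromℕ-1 : fromℕ 1 ≈ 1#
  fromℕ-1 = ℝ.+-identityʳ 1#

  -- If `y ≤ x`, then `x - y ≤ (x - y) * z ≤ 0#`, the first inequality because `1# ≤ z`. This clears
  -- the denominators in `log₂` without division.
  *-cancelʳ-≤ : ∀ {x y z} → 1# ≤ z → x * z ≤ y * z → x ≤ y
  *-cancelʳ-≤ {x} {y} {z} 1≤z xz≤yz with IsTotalOrder.total isTotalOrder x y
  ... | inj₁ x≤y = x≤y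
  ... | inj₂ y≤x = x-y≤0⇒x≤y (begin
    x - y             ≈⟨ ℝ.*-identityʳ (x - y) ⟨
    (x - y) * 1#      ≤⟨ *-monoʳ-≤ (y≤x⇒0≤x-y y≤x) 1≤z ⟩
    (x - y) * z       ≈⟨ [y-z]x≈yx-zx z x y ⟩
    x * z - y * z     ≤⟨ +-mono-≤ xz≤yz ≤-refl ⟩
    y * z - y * z     ≈⟨ ℝ.-‿inverseʳ (y * z) ⟩
    0#                ∎)

  -- The fraction m/1 lies in the set whose supremum is `log₂ k`. Since `sup-upper` asks for some
  -- upper bound of that set, the crude bound `k` is supplied.
  2^m≤k⇒m≤log₂k : ∀ {m k} → 2 ℕ.^ m ℕ.≤ k → fromℕ m ≤ log₂ k
  2^m≤k⇒m≤log₂k {m} {k} 2^m≤k = sup-upper _ (fromℕ m , m∈) (fromℕ k , bounded) (fromℕ m) m∈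
    where
    m∈ = m , 1 , s≤s z≤n ,
         ℝ.trans (ℝ.*-congˡ fromℕ-1) (ℝ.*-identityʳ (fromℕ m)) ,
         subst (2 ℕ.^ m ℕ.≤_) (sym (ℕ.^-identityʳ k)) 2^m≤k

    bounded : IsUpperBound _ (fromℕ k)
    bounded y (a , b , 1≤b , yb≈a , 2^a≤k^b) = *-cancelʳ-≤ 1≤b′ (begin
      y * fromℕ b           ≈⟨ yb≈a ⟩
      fromℕ a               ≤⟨ fromℕ-mono-≤ a≤kb ⟩
      fromℕ (k ℕ.* b)       ≈⟨ fromℕ-homo-* k b ⟩
      fromℕ k * fromℕ b     ∎)
      where
      1≤b′ : 1# ≤ fromℕ b
      1≤b′ = ≤-trans (≤-reflexive (ℝ.sym fromℕ-1)) (fromℕ-mono-≤ 1≤b)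

      -- From `k < 2 ^ k` follows `2 ^ a ≤ k ^ b ≤ 2 ^ (k * b)`.
      a≤kb : a ℕ.≤ k ℕ.* b
      a≤kb = ℕ.≮⇒≥ λ kb<a → ℕ.<⇒≱ (ℕ.^-monoʳ-< 2 (s≤s (s≤s z≤n)) kb<a)
        (ℕ.≤-trans 2^a≤k^b (ℕ.≤-trans (ℕ.^-monoˡ-≤ b (ℕ.<⇒≤ (n<2^n k)))
          (ℕ.≤-reflexive (ℕ.^-*-assoc 2 k b))))

-- The inputs read by straight-line programs, and a lower bound for the cost of multiplication.

module ProgramInputs (R : RealNumbers) where

  open RealNumbers R
  open RealComputation R
  private module ℝ = CommutativeRing commutativeRing
  open Algebra.Properties.Monoid.Sum ℝ.+-monoid using (sum-cong-≋; sum-replicate-zero)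

  module _ {I : Set} where

    -- Inputs are listed with repetitions, so lengths add up instruction by instruction.
    operandInputs : ∀ {s} → Operand I s → List I
    operandInputs (input e)    = e ∷ []
    operandInputs (register j) = []
    operandInputs (constant c) = []

    instructionInputs : ∀ {s} → Instruction I s → List I
    instructionInputs (add a b) = operandInputs a ++ operandInputs b
    instructionInputs (sub a b) = operandInputs a ++ operandInputs b
    instructionInputs (mul a b) = operandInputs a ++ operandInputs b
    instructionInputs (div a b) = operandInputs a ++ operandInputs b
    instructionInputs (root a)  = operandInputs a

    programInputs : ∀ {s} → Program I s → List I
    programInputs []      = []
    programInputs (p ▷ e) = instructionInputs e ++ programInputs p

    length-operandInputs : ∀ {s} (a : Operand I s) → length (operandInputs a) ℕ.≤ 1
    length-operandInputs (input e)    = s≤s z≤n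
    length-operandInputs (register j) = z≤n
    length-operandInputs (constant c) = z≤n

    length-instructionInputs : ∀ {s} (e : Instruction I s) →
                               length (instructionInputs e) ℕ.≤ 2
    length-instructionInputs = λ where
        (add a b) → binary a b
        (sub a b) → binary a b
        (mul a b) → binary a b
        (div a b) → binary a b
        (root a)  → ℕ.m≤n⇒m≤1+n (length-operandInputs a)
      where
      binary : ∀ {s} (a b : Operand I s) → length (operandInputs a ++ operandInputs b) ℕ.≤ 2
      binary a b = ℕ.≤-trans (ℕ.≤-reflexive (length-++ (operandInputs a)))
        (ℕ.+-mono-≤ (length-operandInputs a) (length-operandInputs b))

    length-programInputs : ∀ {s} (p : Program I s) → length (programInputs p) ℕ.≤ s ℕ.* 2
    length-programInputs []      = z≤n
    length-programInputs (p ▷ e) = ℕ.≤-trans (ℕ.≤-reflexive (length-++ (instructionInputs e)))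
      (ℕ.+-mono-≤ (length-instructionInputs e) (length-programInputs p))

    value-input : ∀ {x : I → ℝ} {s} {ρ : Vec ℝ s} {e} (a : Operand I s) →
                  e ∈ operandInputs a → value x ρ a ≡ x e
    value-input (input e) (here refl) = refl

    module _ {x y : I → ℝ} where

      value-cong : ∀ {s} {ρ σ : Vec ℝ s} (a : Operand I s) →
                   (∀ {e} → e ∈ operandInputs a → x e ≡ y e) → ρ ≡ σ →
                   value x ρ a ≡ value y σ a
      value-cong (input e)    x≡y ρ≡σ = x≡y (here refl)
      value-cong (register j) x≡y ρ≡σ = cong (λ ρ → lookup ρ j) ρ≡σ
      value-cong (constant c) x≡y ρ≡σ = refl

      -- Agreement is taken up to `≡`, which every operation respects; the total `sup` behind `sqrt`
      -- is not assumed to respect `≈`.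
      execute-cong : ∀ {s} {ρ σ : Vec ℝ s} (e : Instruction I s) →
                     (∀ {i} → i ∈ instructionInputs e → x i ≡ y i) → ρ ≡ σ →
                     execute x ρ e ≡ execute y σ e
      execute-cong {s} {ρ} {σ} e x≡y ρ≡σ = go e x≡y
        where
        left : (a b : Operand I s) →
               (∀ {i} → i ∈ operandInputs a ++ operandInputs b → x i ≡ y i) →
               value x ρ a ≡ value y σ a
        left a b x≡y = value-cong a (x≡y ∘ ∈-++⁺ˡ) ρ≡σ

        right : (a b : Operand I s) →
                (∀ {i} → i ∈ operandInputs a ++ operandInputs b → x i ≡ y i) →
                value x ρ b ≡ value y σ b
        right a b x≡y = value-cong b (x≡y ∘ ∈-++⁺ʳ (operandInputs a)) ρ≡σ

        go : (e : Instruction I s) → (∀ {i} → i ∈ instructionInputs e → x i ≡ y i) →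
             execute x ρ e ≡ execute y σ e
        go (add a b) x≡y = cong₂ _+_ (left a b x≡y) (right a b x≡y)
        go (sub a b) x≡y = cong₂ _-_ (left a b x≡y) (right a b x≡y)
        go (mul a b) x≡y = cong₂ _*_ (left a b x≡y) (right a b x≡y)
        go (div a b) x≡y = cong₂ (λ u v → u * v ⁻¹) (left a b x≡y) (right a b x≡y)
        go (root a)  x≡y = cong sqrt (value-cong a x≡y ρ≡σ)

      run-cong : ∀ {s} (p : Program I s) →
                 (∀ {i} → i ∈ programInputs p → x i ≡ y i) → run x p ≡ run y p
      run-cong []      x≡y = refl
      run-cong (p ▷ e) x≡y = cong₂ _∷_
        (execute-cong e (x≡y ∘ ∈-++⁺ˡ) ρ≡σ) ρ≡σ
        where ρ≡σ = run-cong p (x≡y ∘ ∈-++⁺ʳ (instructionInputs e))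

  sum-single : ∀ {n} (v : Vector ℝ n) l → (∀ j → j ≢ l → v j ≈ 0#) → sum v ≈ v l
  sum-single {suc n} v zero v≈0 = ℝ.trans
    (ℝ.+-congˡ (ℝ.trans (sum-cong-≋ (λ j → v≈0 (suc j) λ ())) (sum-replicate-zero n)))
    (ℝ.+-identityʳ (v zero))
  sum-single {suc n} v (suc l) v≈0 = ℝ.trans
    (ℝ.+-cong (v≈0 zero λ ())
      (sum-single (v ∘ suc) l λ j j≢l → v≈0 (suc j) (j≢l ∘ Fin.suc-injective)))
    (ℝ.+-identityˡ (v (suc l)))

  _≟ᴾ_ : ∀ {n} → DecidableEquality (Fin n × Fin n)
  _≟ᴾ_ = Product.≡-dec Fin._≟_ Fin._≟_

  _≟ᴱ_ : ∀ {n} → DecidableEquality (Entry n)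
  _≟ᴱ_ = Sum.≡-dec _≟ᴾ_ _≟ᴾ_

  singleEntry : ∀ {n} → Fin n × Fin n → ℝ → Matrix n
  singleEntry e a i j = if does (e ≟ᴾ (i , j)) then a else 0#

  module _ {n : ℕ} where

    singleEntry-at : ∀ i l a → singleEntry {n} (i , l) a i l ≡ a
    singleEntry-at i l a rewrite dec-true ((i , l) ≟ᴾ (i , l)) refl = refl

    singleEntry-off : ∀ (e : Fin n × Fin n) i j a → e ≢ (i , j) → singleEntry e a i j ≡ 0#
    singleEntry-off e i j a e≢ rewrite dec-false (e ≟ᴾ (i , j)) e≢ = refl

  module _ {n : ℕ} (mm : MatrixMultiplication n) where

    open MatrixMultiplication mm
    open Data.List.Membership.DecPropositional (_≟ᴱ_ {n}) using (_∈?_)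

    module _ (i l : Fin n) where

      private
        e : Entry n
        e = inj₁ (i , l)

        x : ℝ → ℝ → Entry n → ℝ
        x a b = entries (singleEntry (i , l) a) (λ _ _ → b)

        out : ℝ → ℝ → ℝ
        out a b = product (singleEntry (i , l) a) (λ _ _ → b) i i

        -- Row `i` of the left factor vanishes outside column `l`, so one summand survives.
        out≈ab : ∀ a b → out a b ≈ a * b
        out≈ab a b = ℝ.trans (correct _ _ i i) (ℝ.trans
          (sum-single _ l λ j j≢l → ℝ.trans
            (ℝ.*-congʳ (ℝ.reflexive (singleEntry-off (i , l) i j a λ { refl → j≢l refl })))
            (ℝ.zeroˡ b))
          (ℝ.*-congʳ (ℝ.reflexive (singleEntry-at i l a))))

        -- Changing `a` alters only the input `e`, so a program that never reads `e` cannot notice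
        -- the change.
        agree : ∀ e′ → e ≢ e′ → x 1# 1# e′ ≡ x 0# 1# e′
        agree (inj₁ (i′ , j)) e≢e′ = trans (singleEntry-off (i , l) i′ j 1# (e≢e′ ∘ cong inj₁))
          (sym (singleEntry-off (i , l) i′ j 0# (e≢e′ ∘ cong inj₁)))
        agree (inj₂ _) e≢e′ = refl

        dependsOnA : out 1# 1# ≢ out 0# 1#
        dependsOnA eq = 0≉1 (ℝ.trans (ℝ.sym (ℝ.trans (out≈ab 0# 1#) (ℝ.zeroˡ 1#)))
          (ℝ.trans (ℝ.reflexive (sym eq)) (ℝ.trans (out≈ab 1# 1#) (ℝ.*-identityˡ 1#))))

        notA : out 1# 0# ≢ 1#
        notA eq = 0≉1 (ℝ.trans (ℝ.sym (ℝ.trans (out≈ab 1# 0#) (ℝ.zeroʳ 1#))) (ℝ.reflexive eq))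

      -- The (i, i) entry of the product of singleEntry (i , l) a with the
      -- constant matrix b is a b, so it depends on a when b = 1 and is not
      -- the input a itself when b = 0.
      readsLeftFactor : e ∈ programInputs program
      readsLeftFactor with e ∈? programInputs program
      ... | yes e∈ = e∈
      ... | no  e∉ with e ∈? operandInputs (output i i)
      ...   | yes e∈ = contradiction
        (trans (value-input (output i i) e∈) (singleEntry-at i l 1#)) notA
      ...   | no  e∉′ = contradiction
        (value-cong (output i i) (λ {e′} e′∈ → agree e′ λ { refl → e∉′ e′∈ })
          (run-cong program λ {e′} e′∈ → agree e′ λ { refl → e∉ e′∈ }))
        dependsOnA

    -- Pigeonhole: every entry of the left factor has a position in the list of inputs read, and
    -- distinct entries have distinct positions. `remQuot` numbers the entries by `Fin (n * n)`.
    n²≤2cost : n ℕ.* n ℕ.≤ cost ℕ.* 2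
    n²≤2cost = ℕ.≤-trans (Fin.injective⇒≤ position-injective) (length-programInputs program)
      where
      inputs = programInputs program

      member : (e : Fin n × Fin n) → inj₁ e ∈ inputs
      member = uncurry readsLeftFactor

      position : Fin (n ℕ.* n) → Fin (length inputs)
      position m = index (member (remQuot {n} n m))

      position-injective : ∀ {m m′} → position m ≡ position m′ → m ≡ m′
      position-injective {m} {m′} eq = begin
        m                               ≡⟨ Fin.combine-remQuot {n} n m ⟨
        uncurry (combine {n}) (remQuot {n} n m)   ≡⟨ cong (uncurry (combine {n})) (Sum.inj₁-injective (begin
          inj₁ (remQuot {n} n m)                ≡⟨ lookup-index (member (remQuot {n} n m)) ⟩
          List.lookup inputs (position m)   ≡⟨ cong (List.lookup inputs) eq ⟩
          List.lookup inputs (position m′)  ≡⟨ lookup-index (member (remQuot {n} n m′)) ⟨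
          inj₁ (remQuot {n} n m′)               ∎)) ⟩
        uncurry (combine {n}) (remQuot {n} n m′)  ≡⟨ Fin.combine-remQuot {n} n m′ ⟩
        m′                              ∎
        where open ≡-Reasoning

-- Step counts of `Hsequence`.

module RunningTime (R : RealNumbers) where

  open RealNumbers R
  open RealComputation R

  steps-entrywise : ∀ n {f : Fin n → Fin n → Timed ℝ} →
                    (∀ i j → steps (f i j) ≡ 1) → steps (entrywise f) ℕ.≤ n ℕ.* n
  steps-entrywise n f≡1 = ℕ.≤-trans
    (steps-forEach n λ i → steps-forEach n λ j → ℕ.≤-reflexive (f≡1 i j))
    (ℕ.≤-reflexive (cong (n ℕ.*_) (ℕ.*-identityʳ n)))

  -- The count is `n`, not `n - 1`, since the summation starts from `0#`.
  steps-sumᵗ : ∀ {n} (v : Vector ℝ n) → steps (sumᵗ v) ≡ n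
  steps-sumᵗ {zero}  v = refl
  steps-sumᵗ {suc n} v = trans (ℕ.+-comm _ 1) (cong suc (steps-sumᵗ (v ∘ suc)))

  module _ {n : ℕ} (mm : MatrixMultiplication n) (A : Matrix n) (q : ℝ) (L : List ℕ) where

    open MatrixMultiplication mm using (cost)
    open Loop mm A q L

    private
      N = n ℕ.* n

    -- The final 0 is the cost of `return`. This bound and the next ones keep the shape of the
    -- unfolded code, so that monotonicity of addition proves them.
    steps-shift : ∀ j r → steps (shift j r) ℕ.≤ suc (N ℕ.+ 0)
    steps-shift j r = s≤s (ℕ.+-monoˡ-≤ 0 (steps-entrywise n λ _ _ → refl))

    steps-evenCase : ∀ i r → steps (evenCase i r) ℕ.≤
                             8 ℕ.+ (1 ℕ.+ (cost ℕ.+ (1 ℕ.+ (N ℕ.+ (N ℕ.+ 1)))))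
    steps-evenCase i r = ℕ.+-monoʳ-≤ 8 (ℕ.+-mono-≤
      (steps-if (does (2 ∣? (L ! (i ℕ.+ toℕ j)))) z≤n (ℕ.≤-refl {1}))
      (ℕ.+-monoʳ-≤ cost (s≤s (ℕ.+-mono-≤ (steps-entrywise n λ _ _ → refl)
        (ℕ.+-monoˡ-≤ 1 (steps-entrywise n λ _ _ → refl))))))
      where
      j : Fin 3
      j = if does (L ! i ℕ.≟ 2 ℕ.* (L ! suc i)) then 1F else 2F

    steps-oddCase : ∀ i r → steps (oddCase i r) ℕ.≤
                            7 ℕ.+ (cost ℕ.+ (N ℕ.+ (N ℕ.+ 1)))
    steps-oddCase i r = ℕ.+-monoʳ-≤ 7 (ℕ.+-monoʳ-≤ cost
      (ℕ.+-mono-≤ (steps-entrywise n λ _ _ → refl)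
        (ℕ.+-monoˡ-≤ 1 (steps-entrywise n λ _ _ → refl))))

    -- Three shifts contribute `3 + 3N`, the parity test of `L ! i` contributes 2, and the dearer
    -- even case `11 + 2N + cost`.
    bodyBound : ℕ
    bodyBound = 16 ℕ.+ N ℕ.* 5 ℕ.+ cost

    steps-body : ∀ i r → steps (body i r) ℕ.≤ bodyBound
    steps-body i r = ℕ.≤-trans
      (ℕ.+-mono-≤ (steps-shift 2F r) (ℕ.+-mono-≤ (steps-shift 1F r₁)
        (ℕ.+-mono-≤ (steps-shift 0F r₂) (ℕ.+-monoʳ-≤ 2
          (steps-if (does (2 ∣? (L ! i))) (steps-evenCase i r₃)
            (ℕ.≤-trans (steps-oddCase i r₃) (odd≤even N cost)))))))
      (ℕ.≤-reflexive (total N cost))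
      where
      r₁ = result (shift 2F r)
      r₂ = result (shift 1F r₁)
      r₃ = result (shift 0F r₂)

      odd≤even : ∀ N c → 7 ℕ.+ (c ℕ.+ (N ℕ.+ (N ℕ.+ 1))) ℕ.≤
                         8 ℕ.+ (1 ℕ.+ (c ℕ.+ (1 ℕ.+ (N ℕ.+ (N ℕ.+ 1)))))
      odd≤even N c = ℕ.+-mono-≤ (ℕ.m≤n+m 7 2) (ℕ.+-monoʳ-≤ c (ℕ.n≤1+n _))

      total : ∀ N c → suc (N ℕ.+ 0) ℕ.+ (suc (N ℕ.+ 0) ℕ.+ (suc (N ℕ.+ 0) ℕ.+ (2 ℕ.+
                (8 ℕ.+ (1 ℕ.+ (c ℕ.+ (1 ℕ.+ (N ℕ.+ (N ℕ.+ 1)))))))))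
              ≡ 16 ℕ.+ N ℕ.* 5 ℕ.+ c
      total = solve-∀

    steps-loop : ∀ i r → steps (loop i r) ℕ.≤ i ℕ.* suc bodyBound
    steps-loop zero    r = z≤n
    steps-loop (suc i) r = s≤s (ℕ.+-mono-≤ (steps-body i r)
      (steps-loop i (result (body i r))))

  steps-Hsequence : ∀ {n} (mm : MatrixMultiplication n) row T₁₋₃ Q₁₋₃ A k .{{_ : NonZero k}} →
    let open MatrixMultiplication mm using (cost)
        q = result (sumᵗ (A row)) - 1#
        L = result (Indices k)
    in steps (Hsequence mm row T₁₋₃ Q₁₋₃ A k) ℕ.≤
       n ℕ.+ (1 ℕ.+ (steps (Indices k) ℕ.+ (1 ℕ.+ (n ℕ.* n ℕ.+ (1 ℕ.+
         ((length L ∸ 1) ℕ.* suc (bodyBound mm A q L) ℕ.+ (2 ℕ.+ (2 ℕ.+ (5 ℕ.+ (n ℕ.+ 3))))))))))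
  steps-Hsequence {n} mm row T₁₋₃ Q₁₋₃ A k =
    ℕ.+-mono-≤ (ℕ.≤-reflexive (steps-sumᵗ (A row))) (s≤s (ℕ.+-monoʳ-≤ (steps (Indices k)) (s≤s
      (ℕ.+-mono-≤ (steps-entrywise n λ _ _ → refl) (s≤s
        (ℕ.+-mono-≤ (steps-loop mm A q L (length L ∸ 1) _) (ℕ.+-monoʳ-≤ 2
          (ℕ.+-mono-≤ (steps-if (does (2 ∣? (L ! 0))) z≤n ℕ.≤-refl) (ℕ.+-monoʳ-≤ 5
            (ℕ.+-monoˡ-≤ 3 (ℕ.≤-reflexive (steps-sumᵗ _))))))))))))
    where
    q = result (sumᵗ (A row)) - 1#
    L = result (Indices k)

-- Collecting all terms into a multiple of cost times exponent.

total≤156wm : ∀ {n N w m M} → 1 ℕ.≤ w → 1 ℕ.≤ m → n ℕ.≤ N → N ℕ.≤ w ℕ.* 2 → M ℕ.≤ m ℕ.* 2 →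
  n ℕ.+ (1 ℕ.+ ((3 ℕ.+ M ℕ.* 10) ℕ.+ (1 ℕ.+ (N ℕ.+ (1 ℕ.+
    (M ℕ.* 2 ℕ.* (17 ℕ.+ N ℕ.* 5 ℕ.+ w) ℕ.+ (2 ℕ.+ (2 ℕ.+ (5 ℕ.+ (n ℕ.+ 3))))))))))
  ℕ.≤ 156 ℕ.* (w ℕ.* m)
total≤156wm {n} {N} {w} {m} {M} 1≤w 1≤m n≤N N≤2w M≤2m = ℕ.≤-trans
  (n≤2z ⊞ (const 1 ⊞ ((const 3 ⊞ ℕ.*-monoˡ-≤ 10 M≤2z) ⊞ (const 1 ⊞ (N≤2z ⊞ (const 1 ⊞
    -- The main loop gives `4m` times `(17 + 10 + 1)w`, that is 112 of the 156; every other term is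
    -- a multiple of `w * m` by itself.
    (ℕ.*-mono-≤ (ℕ.*-monoˡ-≤ 2 M≤2m)
       ((ℕ.*-monoʳ-≤ 17 1≤w ⊞ ℕ.*-monoˡ-≤ 5 N≤2w) ⊞ ℕ.≤-refl {w}) ⊞
    (const 2 ⊞ (const 2 ⊞ (const 5 ⊞ (n≤2z ⊞ const 3)))))))))))
  (ℕ.≤-reflexive (collect w m))
  where
  infixr 4 _⊞_
  _⊞_ : ∀ {a b c d} → a ℕ.≤ b → c ℕ.≤ d → a ℕ.+ c ℕ.≤ b ℕ.+ d
  _⊞_ = ℕ.+-mono-≤

  z = w ℕ.* m

  const : ∀ a → a ℕ.≤ a ℕ.* z
  const a = ℕ.≤-trans (ℕ.≤-reflexive (sym (ℕ.*-identityʳ a)))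
    (ℕ.*-monoʳ-≤ a (ℕ.*-mono-≤ 1≤w 1≤m))

  N≤2z : N ℕ.≤ z ℕ.* 2
  N≤2z = ℕ.≤-trans N≤2w (ℕ.*-monoˡ-≤ 2 (ℕ.m≤m*n w m {{ℕ.>-nonZero 1≤m}}))

  n≤2z : n ℕ.≤ z ℕ.* 2
  n≤2z = ℕ.≤-trans n≤N N≤2z

  M≤2z : M ℕ.≤ z ℕ.* 2
  M≤2z = ℕ.≤-trans M≤2m (ℕ.*-monoˡ-≤ 2 (ℕ.m≤n*m m w {{ℕ.>-nonZero 1≤w}}))

  collect : ∀ w m → let z = w ℕ.* m in
    z ℕ.* 2 ℕ.+ (1 ℕ.* z ℕ.+ ((3 ℕ.* z ℕ.+ z ℕ.* 2 ℕ.* 10) ℕ.+ (1 ℕ.* z ℕ.+ (z ℕ.* 2 ℕ.+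
      (1 ℕ.* z ℕ.+ (m ℕ.* 2 ℕ.* 2 ℕ.* (17 ℕ.* w ℕ.+ w ℕ.* 2 ℕ.* 5 ℕ.+ w) ℕ.+
      (2 ℕ.* z ℕ.+ (2 ℕ.* z ℕ.+ (5 ℕ.* z ℕ.+ (z ℕ.* 2 ℕ.+ 3 ℕ.* z))))))))))
    ≡ 156 ℕ.* z
  collect = solve-∀

-- The bound in terms of `n ^ℝ ω` and `log₂ k`.

theorem2p6 : (R : RealNumbers) →
    let open RealNumbers R
        open RealComputation R
        open MatrixMultiplication using (cost)
    in
    (ω : ℝ) (mm : (n : ℕ) → MatrixMultiplication n) →
    ∃ (λ c → (n : ℕ) → 2 ℕ.≤ n → fromℕ (cost (mm n)) ≤ c * n ^ℝ ω) →
    ∃ λ C →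
      (q n k : ℕ) .{{_ : NonZero k}} → 1 ℕ.≤ q → 2 ℕ.≤ n → 2 ℕ.≤ k →
      (X : RegularGraph (q ℕ.+ 1) n) →
      (row : Fin n) (T₁₋₃ : Vec (Matrix n) 3) (Q₁₋₃ : Vec ℝ 3) →
      fromℕ (steps (Hsequence (mm n) row T₁₋₃ Q₁₋₃ (adjacencyMatrix X) k))
        ≤ C * n ^ℝ ω * log₂ k
theorem2p6 R ω mm (c , cost≤) = fromℕ 156 * c , bound
  where
  open RealNumbers R
  open RealComputation R
  open RealProperties R
  open ProgramInputs R using (n²≤2cost)
  open RunningTime R using (steps-Hsequence; bodyBound)
  open MatrixMultiplication using (cost)
  module ℝ = CommutativeRing commutativeRing

  -- Transfers a bound from natural numbers to reals; the nonnegativity of `c * x` is inherited from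
  -- `fromℕ w ≤ c * x`.
  scale : ∀ a {s} w m {x y} → s ℕ.≤ a ℕ.* (w ℕ.* m) → fromℕ w ≤ c * x → fromℕ m ≤ y →
          fromℕ s ≤ fromℕ a * c * x * y
  scale a {s} w m {x} {y} s≤ w≤ m≤ = begin
    fromℕ s                       ≤⟨ fromℕ-mono-≤ s≤ ⟩
    fromℕ (a ℕ.* (w ℕ.* m))       ≈⟨ fromℕ-homo-* a (w ℕ.* m) ⟩
    fromℕ a * fromℕ (w ℕ.* m)     ≈⟨ ℝ.*-congˡ (fromℕ-homo-* w m) ⟩
    fromℕ a * (fromℕ w * fromℕ m) ≤⟨ *-monoʳ-≤ (0≤fromℕ a)
                                       (*-mono-≤ (≤-trans (0≤fromℕ w) w≤) (0≤fromℕ m) w≤ m≤) ⟩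
    fromℕ a * (c * x * y)         ≈⟨ ℝ.*-assoc (fromℕ a) (c * x) y ⟨
    fromℕ a * (c * x) * y         ≈⟨ ℝ.*-congʳ (ℝ.*-assoc (fromℕ a) c x) ⟨
    fromℕ a * c * x * y           ∎
    where open Relation.Binary.Reasoning.PartialOrder poset

  bound : (q n k : ℕ) .{{_ : NonZero k}} → 1 ℕ.≤ q → 2 ℕ.≤ n → 2 ℕ.≤ k →
    (X : RegularGraph (q ℕ.+ 1) n) →
    (row : Fin n) (T₁₋₃ : Vec (Matrix n) 3) (Q₁₋₃ : Vec ℝ 3) →
    fromℕ (steps (Hsequence (mm n) row T₁₋₃ Q₁₋₃ (adjacencyMatrix X) k))
      ≤ fromℕ 156 * c * n ^ℝ ω * log₂ k
  bound q n k _ 2≤n 2≤k X row T₁₋₃ Q₁₋₃ with binaryMagnitude k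
  -- Here `2 ≤ k` enters: it forces `1 ≤ m`, which lets additive constants be absorbed.
  ... | zero  , _  , k<2 = contradiction 2≤k (ℕ.<⇒≱ k<2)
  ... | m@(suc m-1) , lo , hi = scale 156 w m steps≤ (cost≤ n 2≤n) (2^m≤k⇒m≤log₂k {m} lo)
    where
    A = adjacencyMatrix X
    w = cost (mm n)
    L = result (Indices k)

    n≤n² : n ℕ.≤ n ℕ.* n
    n≤n² = ℕ.m≤m*n n n {{ℕ.>-nonZero (ℕ.<⇒≤ 2≤n)}}

    -- Cost zero would force `n * n ≤ 0`.
    1≤w : 1 ℕ.≤ w
    1≤w = ℕ.n≢0⇒n>0 λ w≡0 → ℕ.<⇒≱ (ℕ.<⇒≤ 2≤n)
      (ℕ.≤-trans n≤n² (subst (λ w → n ℕ.* n ℕ.≤ w ℕ.* 2) w≡0 (n²≤2cost (mm n))))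

    -- The exponent is `m + 1`, because `k` may lie strictly between `2 ^ m` and `2 ^ suc m`.
    Indices≤ = Indices-bounds (suc m) k (ℕ.<⇒≤ hi)

    steps≤ : steps (Hsequence (mm n) row T₁₋₃ Q₁₋₃ A k) ℕ.≤ 156 ℕ.* (w ℕ.* m)
    steps≤ = ℕ.≤-trans (steps-Hsequence (mm n) row T₁₋₃ Q₁₋₃ A k) (ℕ.≤-trans
      (ℕ.+-monoʳ-≤ n (s≤s (ℕ.+-mono-≤ (proj₁ Indices≤) (s≤s (ℕ.+-monoʳ-≤ (n ℕ.* n) (s≤s
        (ℕ.+-monoˡ-≤ _ (ℕ.*-monoˡ-≤ _ (ℕ.∸-monoˡ-≤ 1 (proj₂ Indices≤))))))))))
      (total≤156wm 1≤w (s≤s z≤n) n≤n² (n²≤2cost (mm n))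
        -- This is `m + 1 ≤ 2m`, written with `m = suc m-1`.
        (s≤s (s≤s (ℕ.m≤m*n m-1 2)))))
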